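{- Let $G$ be a (finite, simple, non-null) graph without isolated vertices such that $\Delta(G)-\delta(G)\leq 3$. If either $\delta(G)\neq 2$ or $\Delta(G)\neq 5$ holds, then $$\frac{M_1(G)}{n(G)}\leq\frac{M_2(G)}{m(G)}.$$ Equality holds if and only if $\mathbb{F}(G)$ is one of $\{\{\Delta(G),\delta(G)\}\}$, $\{\{1,4\},\{2,2\}\}$, or $\{\{3,6\},\{4,4\}\}$.
   Context: All graphs are finite, simple, non-null and have no isolated vertices (they need not be connected). For a graph $G$ with vertex set $V(G)$ and edge set $E(G)$: $n(G)=|V(G)|$ is the order, $m(G)=|E(G)|$ is the size, $d_G(u)$ is the degree of a vertex $u$, and $\Delta(G)$ and $\delta(G)$ are the maximum and minimum degrees. The first and second Zagreb indices are $M_1(G)=\sum_{v\in V(G)}d_G(v)^2$ and $M_2(G)=\sum_{uv\in E(G)}d_G(u)d_G(v)$. The set $\mathbb{F}(G)=\{\{d_G(u),d_G(v)\}: uv\in E(G)\}$ is the set of unordered pairs (possibly with repeated entry, e.g. $\{2,2\}$) of degrees of endpoints of edges of $G$. -}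

module Defs where

open import Data.Fin.Base using (Fin; _<_)
open import Data.Fin.Properties using (_<?_; <-cmp)
open import Data.List.Base
  using (List; []; _∷_; length; map; filter; allFin; cartesianProduct)
open import Data.List.Extrema.Nat using (max; min)
open import Data.List.Membership.Propositional using (_∈_)
open import Data.List.Membership.Propositional.Properties
  using (∈-allFin; ∈-cartesianProduct⁺; ∈-filter⁺; ∈-length)
open import Data.List.Relation.Unary.Any using (Any)
open import Data.Nat.Base as ℕ using (ℕ; suc; _*_; _^_; NonZero; >-nonZero)
open import Data.Nat.ListAction using (sum)
open import Data.Product.Base using (_×_; _,_; ∃; ∃₂)
open import Data.Sum.Base using (_⊎_)
open import Level using (0ℓ)
open import Relation.Binary.Core using (Rel)
open import Relation.Binary.Definitions
  using (Symmetric; Irreflexive; Decidable; tri<; tri≈; tri>)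
open import Relation.Binary.PropositionalEquality using (_≡_; refl)
open import Relation.Nullary using (contradiction)
open import Relation.Nullary.Decidable using (_×-dec_)
import Relation.Unary as U

record Graph : Set₁ where
  field
    order  : ℕ
    Adj    : Rel (Fin order) 0ℓ
    adj?   : Decidable Adj
    symm   : Symmetric Adj
    irrefl : Irreflexive _≡_ Adj

open Graph public

Vertex : Graph → Set
Vertex G = Fin (order G)

vertices : (G : Graph) → List (Vertex G)
vertices G = allFin (order G)

-- Each edge is listed once, with its smaller endpoint first.
IsEdge : (G : Graph) → U.Pred (Vertex G × Vertex G) 0ℓ
IsEdge G (u , v) = u < v × Adj G u v

isEdge? : (G : Graph) → U.Decidable (IsEdge G)
isEdge? G (u , v) = (u <? v) ×-dec adj? G u v

edges : (G : Graph) → List (Vertex G × Vertex G)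
edges G = filter (isEdge? G) (cartesianProduct (vertices G) (vertices G))

size : Graph → ℕ
size G = length (edges G)

degree : (G : Graph) → Vertex G → ℕ
degree G u = length (filter (adj? G u) (vertices G))

degrees : Graph → List ℕ
degrees G = map (degree G) (vertices G)

Δ : Graph → ℕ
Δ G = max 0 (degrees G)

-- The first argument of min is an upper bound on the result; Δ G bounds every
-- degree, so for a non-null graph this is the least degree.
δ : Graph → ℕ
δ G = min (Δ G) (degrees G)

M₁ : Graph → ℕ
M₁ G = sum (map (λ v → degree G v ^ 2) (vertices G))

M₂ : Graph → ℕ
M₂ G = sum (map (λ (u , v) → degree G u * degree G v) (edges G))

NoIsolated : Graph → Set
NoIsolated G = ∀ u → ∃ λ v → Adj G u v

-- (a , b) ≈ (c , d) says that {a, b} = {c, d} as unordered pairs.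
infix 4 _≈_
_≈_ : Rel (ℕ × ℕ) 0ℓ
(a , b) ≈ (c , d) = (a ≡ c × b ≡ d) ⊎ (a ≡ d × b ≡ c)

-- Sets of unordered pairs are the predicates on ℕ × ℕ that respect _≈_; both 𝔽 G
-- and ⟪ ps ⟫ do, and two such sets are equal when they are related by U._≐_.
𝔽 : Graph → U.Pred (ℕ × ℕ) 0ℓ
𝔽 G p = ∃₂ λ u v → Adj G u v × p ≈ (degree G u , degree G v)

⟪_⟫ : List (ℕ × ℕ) → U.Pred (ℕ × ℕ) 0ℓ
⟪ ps ⟫ p = Any (p ≈_) ps

size-nonZero : (G : Graph) .{{_ : NonZero (order G)}} → NoIsolated G → NonZero (size G)
size-nonZero G@(record { order = suc _ }) noIso with noIso Fin.zero
... | v , a = >-nonZero (nonempty Fin.zero v a)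
  where
  listed : ∀ u v → IsEdge G (u , v) → (u , v) ∈ edges G
  listed u v = ∈-filter⁺ (isEdge? G) (∈-cartesianProduct⁺ (∈-allFin u) (∈-allFin v))

  nonempty : ∀ u v → Adj G u v → 0 ℕ.< size G
  nonempty u v a with <-cmp u v
  ... | tri< u<v _ _ = ∈-length (listed u v (u<v , a))
  ... | tri≈ _ u≡v _ = contradiction a (irrefl G u≡v)
  ... | tri> _ _ v<u = ∈-length (listed v u (v<u , symm G a))

{-# OPTIONS --safe #-}

-- Put W(a , b) = L / a + L / b for a common multiple L of the degrees, and
-- π(a , b) = a b, σ(a , b) = a + b. Double counting over the edges gives
-- n L = Σ W and M₁ = Σ σ, and π W = L σ, so the claim m (Σ π W) ≤ (Σ π) (Σ W) is
-- Chebyshev's sum inequality: it holds as soon as π and W are oppositely ordered on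
-- the edges, with equality iff any two edges agree in π or in W. Componentwise
-- comparable pairs are oppositely ordered; otherwise one pair lies strictly inside
-- the other, and as all degrees lie in an interval of length 3 only four shapes
-- occur. Of these only {i , i + 3} against {i + 1 , i + 1} is delicate: it ties in π
-- at i = 1, fails at i = 2 and ties in W at i = 3.

module Submission where

open import Defs
open import Data.Bool.Base using (true; false; if_then_else_)
import Data.Fin.Base as Fin
open import Data.Fin.Properties using (<-cmp)
open import Data.Integer.Base as ℤ using (+_)
import Data.Integer.Properties as ℤ
open import Data.List.Base
  using (List; []; _∷_; _++_; length; map; filter; cartesianProduct)
open import Data.List.Extrema.Nat using (xs≤max; min≤xs; max≤v⁺; v≤min⁺)
open import Data.List.Membership.Propositional using (_∈_; find; lose)
open import Data.List.Membership.Propositional.Properties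
  using (∈-allFin; ∈-cartesianProduct⁺; ∈-filter⁺; ∈-filter⁻; ∈-length; ∈-map⁺; ∈-map⁻)
open import Data.List.Properties using (length-map; length-tabulate; map-++; map-∘; map-cong)
open import Data.List.Relation.Unary.All as All using (All)
import Data.List.Relation.Unary.All.Properties as All
open import Data.List.Relation.Unary.Any using (here; there)
open import Data.Nat.Base hiding (compare; _/_)
open import Data.Nat.Divisibility using (m≤n⇒m!∣n!; ∣-trans; m∣m*n)
open import Data.Nat.DivMod as ℕ using (m*[n/m]≡n)
open import Data.Nat.ListAction using (sum)
open import Data.Nat.ListAction.Properties using (sum-++)
open import Data.Nat.Properties hiding (<-cmp)
open import Data.Nat.Tactic.RingSolver using (solve-∀)
open import Data.Product.Base using (_×_; _,_; proj₁; proj₂; ∃; ∃₂)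
open import Data.Rational.Base as ℚ using (_/_)
import Data.Rational.Properties as ℚ
open import Data.Rational.Unnormalised.Base as ℚᵘ using (mkℚᵘ)
import Data.Rational.Unnormalised.Properties as ℚᵘ
open import Data.Sum.Base as Sum using (_⊎_; inj₁; inj₂)
open import Function.Base using (_∘_; it)
open import Function.Bundles using (_⇔_; mk⇔; Equivalence)
open import Relation.Binary.Definitions using (Decidable; tri<; tri≈; tri>)
open import Relation.Binary.PropositionalEquality
  using (_≡_; _≢_; refl; sym; trans; cong; cong₂; subst; subst₂; module ≡-Reasoning)
open import Relation.Nullary using (Dec; yes; no; ¬_; contradiction; does)
open import Relation.Nullary.Decidable using (_×-dec_; _⊎-dec_)
open import Relation.Unary as U using (_≐_)
open import Relation.Unary.Properties using (≐-sym; ≐-trans)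

private variable
  A B : Set

-- Finite sums over lists

∑ : List A → (A → ℕ) → ℕ
∑ xs f = sum (map f xs)

∑-cong : ∀ (xs : List A) {f g} → (∀ x → f x ≡ g x) → ∑ xs f ≡ ∑ xs g
∑-cong xs f≗g = cong sum (map-cong f≗g xs)

∑-++ : ∀ (xs ys : List A) f → ∑ (xs ++ ys) f ≡ ∑ xs f + ∑ ys f
∑-++ xs ys f = trans (cong sum (map-++ f xs ys)) (sum-++ (map f xs) (map f ys))

∑-map : ∀ (h : A → B) xs f → ∑ (map h xs) f ≡ ∑ xs (f ∘ h)
∑-map h xs f = cong sum (sym (map-∘ xs))

∑-const : ∀ (xs : List A) c → ∑ xs (λ _ → c) ≡ length xs * c
∑-const []       c = refl
∑-const (_ ∷ xs) c = cong (_+_ c) (∑-const xs c)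

∑-+ : ∀ (xs : List A) f g → ∑ xs (λ x → f x + g x) ≡ ∑ xs f + ∑ xs g
∑-+ []       f g = refl
∑-+ (x ∷ xs) f g =
  trans (cong (_+_ (f x + g x)) (∑-+ xs f g)) (interchange (f x) (g x) (∑ xs f) (∑ xs g))
  where
  interchange : ∀ a b c d → a + b + (c + d) ≡ a + c + (b + d)
  interchange = solve-∀

∑-*ˡ : ∀ (xs : List A) c f → ∑ xs (λ x → c * f x) ≡ c * ∑ xs f
∑-*ˡ []       c f = sym (*-zeroʳ c)
∑-*ˡ (x ∷ xs) c f =
  trans (cong (_+_ (c * f x)) (∑-*ˡ xs c f)) (sym (*-distribˡ-+ c (f x) (∑ xs f)))

∑-*ʳ : ∀ (xs : List A) c f → ∑ xs (λ x → f x * c) ≡ ∑ xs f * c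
∑-*ʳ xs c f = trans (∑-cong xs (λ x → *-comm (f x) c)) (trans (∑-*ˡ xs c f) (*-comm c (∑ xs f)))

∑-swap : ∀ (xs : List A) (ys : List B) (f : A → B → ℕ) →
         ∑ xs (λ x → ∑ ys (f x)) ≡ ∑ ys (λ y → ∑ xs (λ x → f x y))
∑-swap []       ys f = sym (trans (∑-const ys 0) (*-zeroʳ (length ys)))
∑-swap (x ∷ xs) ys f =
  trans (cong (_+_ (∑ ys (f x))) (∑-swap xs ys f)) (sym (∑-+ ys (f x) (λ y → ∑ xs (λ z → f z y))))

∑-cartesianProduct : ∀ (xs : List A) (ys : List B) f →
  ∑ (cartesianProduct xs ys) f ≡ ∑ xs (λ x → ∑ ys (λ y → f (x , y)))
∑-cartesianProduct []       ys f = refl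
∑-cartesianProduct (x ∷ xs) ys f =
  trans (∑-++ (map (x ,_) ys) (cartesianProduct xs ys) f)
        (cong₂ _+_ (∑-map (x ,_) ys f) (∑-cartesianProduct xs ys f))

∑-mono : ∀ (xs : List A) {f g} → (∀ {x} → x ∈ xs → f x ≤ g x) → ∑ xs f ≤ ∑ xs g
∑-mono []       f≤g = z≤n
∑-mono (x ∷ xs) f≤g = +-mono-≤ (f≤g (here refl)) (∑-mono xs (f≤g ∘ there))

-- A strict inequality at any one entry would make the whole sum strictly smaller, the remaining
-- entries being ordered weakly. This extracts the equality case of the theorem.
∑-mono-tight : ∀ (xs : List A) {f g} → (∀ {x} → x ∈ xs → f x ≤ g x) →
               ∑ xs f ≡ ∑ xs g → ∀ {x} → x ∈ xs → f x ≡ g x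
∑-mono-tight (y ∷ ys) {f} {g} f≤g eq = λ where
    (here refl) → fy≡gy
    (there x∈)  → ∑-mono-tight ys (f≤g ∘ there) rest x∈
  where
  fy≡gy : f y ≡ g y
  fy≡gy with m≤n⇒m<n∨m≡n (f≤g (here refl))
  ... | inj₁ fy<gy = contradiction eq (<⇒≢ (+-mono-<-≤ fy<gy (∑-mono ys (f≤g ∘ there))))
  ... | inj₂ fy≡gy = fy≡gy

  rest : ∑ ys f ≡ ∑ ys g
  rest = +-cancelˡ-≡ (f y) _ _ (trans eq (cong (_+ ∑ ys g) (sym fy≡gy)))

-- The Iverson bracket. It turns a sum over a filtered list into a weighted sum over the full list,
-- where the order of summation can be exchanged.
⟦_⟧ : {P : Set} → Dec P → ℕ
⟦ P? ⟧ = if does P? then 1 else 0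

⟦⟧-yes : ∀ {P : Set} (P? : Dec P) → P → ⟦ P? ⟧ ≡ 1
⟦⟧-yes (yes _)  _ = refl
⟦⟧-yes (no ¬p)  p = contradiction p ¬p

⟦⟧-no : ∀ {P : Set} (P? : Dec P) → ¬ P → ⟦ P? ⟧ ≡ 0
⟦⟧-no (yes p) ¬p = contradiction p ¬p
⟦⟧-no (no _)  _  = refl

∑-filter : ∀ {P : A → Set} (P? : U.Decidable P) xs f →
           ∑ (filter P? xs) f ≡ ∑ xs (λ x → ⟦ P? x ⟧ * f x)
∑-filter P? []       f = refl
∑-filter P? (x ∷ xs) f with does (P? x)
... | true  = cong₂ _+_ (sym (+-identityʳ (f x))) (∑-filter P? xs f)
... | false = ∑-filter P? xs f

-- Chebyshev's sum inequality

Opposed : (f g : A → ℕ) → A → A → Set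
Opposed f g x y = (f x ≤ f y × g y ≤ g x) ⊎ (f y ≤ f x × g x ≤ g y)

Tied : (f g : A → ℕ) → A → A → Set
Tied f g x y = f x ≡ f y ⊎ g x ≡ g y

rearrangement-identity : ∀ a b c d → (a + c) * (b + d) + a * b ≡ c * d + (a * (b + d) + (a + c) * b)
rearrangement-identity = solve-∀

private
  module Difference {a a′ b b′} (a≤a′ : a ≤ a′) (b′≤b : b′ ≤ b) where
    c d : ℕ
    c = a′ ∸ a
    d = b ∸ b′

    a+c : a + c ≡ a′
    a+c = m+[n∸m]≡n a≤a′

    b′+d : b′ + d ≡ b
    b′+d = m+[n∸m]≡n b′≤b

    -- With `a′ = a + c` and `b = b′ + d`, the two sums differ by exactly `c * d`. The rearrangement
    -- inequality is its nonnegativity, and equality forces one of the gaps to vanish.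
    excess : a * b′ + a′ * b ≡ c * d + (a * b + a′ * b′)
    excess = begin
      a * b′ + a′ * b                      ≡⟨ +-comm (a * b′) (a′ * b) ⟩
      a′ * b + a * b′                      ≡⟨ cong₂ (λ x y → x * y + a * b′) a+c b′+d ⟨
      (a + c) * (b′ + d) + a * b′          ≡⟨ rearrangement-identity a b′ c d ⟩
      c * d + (a * (b′ + d) + (a + c) * b′)
        ≡⟨ cong₂ (λ x y → c * d + (a * y + x * b′)) a+c b′+d ⟩
      c * d + (a * b + a′ * b′)            ∎
      where open ≡-Reasoning

rearrangement : ∀ {a a′ b b′} → a ≤ a′ → b′ ≤ b → a * b + a′ * b′ ≤ a * b′ + a′ * b
rearrangement {a} {a′} {b} {b′} a≤a′ b′≤b =
  ≤-trans (m≤n+m (a * b + a′ * b′) (c * d)) (≤-reflexive (sym excess))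
  where open Difference a≤a′ b′≤b

rearrangement-tight : ∀ {a a′ b b′} → a ≤ a′ → b′ ≤ b →
                      a * b + a′ * b′ ≡ a * b′ + a′ * b → a ≡ a′ ⊎ b ≡ b′
rearrangement-tight {a} {a′} {b} {b′} a≤a′ b′≤b eq =
  Sum.map (λ c≡0 → trans (sym (+-identityʳ a)) (trans (cong (_+_ a) (sym c≡0)) a+c))
          (λ d≡0 → sym (trans (sym (+-identityʳ b′)) (trans (cong (_+_ b′) (sym d≡0)) b′+d)))
          (m*n≡0⇒m≡0∨n≡0 c cd≡0)
  where
  open Difference a≤a′ b′≤b
  cd≡0 : c * d ≡ 0
  cd≡0 = +-cancelʳ-≡ (a * b + a′ * b′) (c * d) 0 (sym (trans eq excess))

module Chebyshev {A : Set} (xs : List A) (f g : A → ℕ) where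

  private
    -- Summed over all ordered pairs of entries, these give twice the two sides of Chebyshev's
    -- inequality, which thereby reduces to the rearrangement inequality for each pair of entries.
    diagonal crossed : A → A → ℕ
    diagonal x y = f x * g x + f y * g y
    crossed  x y = f x * g y + f y * g x

    S : ℕ
    S = ∑ xs (λ x → f x * g x)

    T : ℕ
    T = ∑ xs f * ∑ xs g

    ∑-diagonal : ∑ xs (λ x → ∑ xs (diagonal x)) ≡ 2 * (length xs * S)
    ∑-diagonal = begin
      ∑ xs (λ x → ∑ xs (diagonal x))
        ≡⟨ ∑-cong xs (λ x → trans (∑-+ xs (λ _ → f x * g x) (λ y → f y * g y))
                                  (cong (_+ S) (∑-const xs (f x * g x)))) ⟩
      ∑ xs (λ x → length xs * (f x * g x) + S)
        ≡⟨ ∑-+ xs (λ x → length xs * (f x * g x)) (λ _ → S) ⟩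
      ∑ xs (λ x → length xs * (f x * g x)) + ∑ xs (λ _ → S)
        ≡⟨ cong₂ _+_ (∑-*ˡ xs (length xs) (λ x → f x * g x)) (∑-const xs S) ⟩
      length xs * S + length xs * S
        ≡⟨ cong (_+_ (length xs * S)) (+-identityʳ (length xs * S)) ⟨
      2 * (length xs * S) ∎
      where open ≡-Reasoning

    ∑-crossed : ∑ xs (λ x → ∑ xs (crossed x)) ≡ 2 * T
    ∑-crossed = begin
      ∑ xs (λ x → ∑ xs (crossed x))
        ≡⟨ ∑-cong xs (λ x → trans (∑-+ xs (λ y → f x * g y) (λ y → f y * g x))
                                  (cong₂ _+_ (∑-*ˡ xs (f x) g) (∑-*ʳ xs (g x) f))) ⟩
      ∑ xs (λ x → f x * ∑ xs g + ∑ xs f * g x)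
        ≡⟨ ∑-+ xs (λ x → f x * ∑ xs g) (λ x → ∑ xs f * g x) ⟩
      ∑ xs (λ x → f x * ∑ xs g) + ∑ xs (λ x → ∑ xs f * g x)
        ≡⟨ cong₂ _+_ (∑-*ʳ xs (∑ xs g) f) (∑-*ˡ xs (∑ xs f) g) ⟩
      T + T
        ≡⟨ cong (_+_ T) (+-identityʳ T) ⟨
      2 * T ∎
      where open ≡-Reasoning

    diagonal≤crossed : ∀ {x y} → Opposed f g x y → diagonal x y ≤ crossed x y
    diagonal≤crossed (inj₁ (fx≤fy , gy≤gx)) = rearrangement fx≤fy gy≤gx
    diagonal≤crossed {x} {y} (inj₂ (fy≤fx , gx≤gy)) =
      subst₂ _≤_ (+-comm (f y * g y) _) (+-comm (f y * g x) _) (rearrangement fy≤fx gx≤gy)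

    diagonal≡crossed⇒tied : ∀ {x y} → Opposed f g x y → diagonal x y ≡ crossed x y → Tied f g x y
    diagonal≡crossed⇒tied (inj₁ (fx≤fy , gy≤gx)) = rearrangement-tight fx≤fy gy≤gx
    diagonal≡crossed⇒tied {x} {y} (inj₂ (fy≤fx , gx≤gy)) eq =
      Sum.map sym sym (rearrangement-tight fy≤fx gx≤gy
        (trans (+-comm (f y * g y) _) (trans eq (+-comm (f x * g y) _))))

    tied⇒crossed≤diagonal : ∀ {x y} → Tied f g x y → crossed x y ≤ diagonal x y
    tied⇒crossed≤diagonal {x} {y} (inj₁ fx≡fy) rewrite fx≡fy = ≤-reflexive (+-comm (f y * g y) _)
    tied⇒crossed≤diagonal {x} {y} (inj₂ gx≡gy) rewrite gx≡gy = ≤-refl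

    halve-≤ : ∀ {a b} → 2 * a ≤ 2 * b → a ≤ b
    halve-≤ = *-cancelˡ-≤ 2

  module _ (opposed : ∀ {x y} → x ∈ xs → y ∈ xs → Opposed f g x y) where

    chebyshev : length xs * S ≤ T
    chebyshev = halve-≤ (subst₂ _≤_ ∑-diagonal ∑-crossed
      (∑-mono xs (λ x∈ → ∑-mono xs (λ y∈ → diagonal≤crossed (opposed x∈ y∈)))))

    chebyshev-≡⇒tied : length xs * S ≡ T → ∀ {x y} → x ∈ xs → y ∈ xs → Tied f g x y
    chebyshev-≡⇒tied eq x∈ y∈ = diagonal≡crossed⇒tied (opposed x∈ y∈)
      -- Tightness is used twice: the inner application, on the outer sum, makes the row of `x`
      -- tight; the outer one then makes its entry at `y` tight.
      (∑-mono-tight xs (λ y∈ → diagonal≤crossed (opposed x∈ y∈))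
        (∑-mono-tight xs (λ x∈ → ∑-mono xs (λ y∈ → diagonal≤crossed (opposed x∈ y∈)))
          (trans ∑-diagonal (trans (cong (2 *_) eq) (sym ∑-crossed))) x∈) y∈)

    tied⇒chebyshev-≡ : (∀ {x y} → x ∈ xs → y ∈ xs → Tied f g x y) → length xs * S ≡ T
    tied⇒chebyshev-≡ tied = ≤-antisym chebyshev (halve-≤ (subst₂ _≤_ ∑-crossed ∑-diagonal
      (∑-mono xs (λ x∈ → ∑-mono xs (λ y∈ → tied⇒crossed≤diagonal (tied x∈ y∈))))))

-- Double counting over edges

module _ (G : Graph) where

  private
    V = vertices G
    ε : Vertex G → Vertex G → ℕ
    ε u v = ⟦ isEdge? G (u , v) ⟧

  -- An edge is listed in one orientation only, so exactly one of the two brackets is 1 when the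
  -- vertices are adjacent. Irreflexivity excludes the diagonal.
  ε-symmetrised : ∀ u v (a? : Dec (Adj G u v)) → ε u v + ε v u ≡ ⟦ a? ⟧
  ε-symmetrised u v (no ¬a) = cong₂ _+_ (⟦⟧-no (isEdge? G (u , v)) (¬a ∘ proj₂))
                                        (⟦⟧-no (isEdge? G (v , u)) (¬a ∘ symm G ∘ proj₂))
  ε-symmetrised u v (yes a) with <-cmp u v
  ... | tri< u<v _ v≮u = cong₂ _+_ (⟦⟧-yes (isEdge? G (u , v)) (u<v , a))
                                   (⟦⟧-no (isEdge? G (v , u)) (v≮u ∘ proj₁))
  ... | tri≈ _ u≡v _   = contradiction a (irrefl G u≡v)
  ... | tri> u≮v _ v<u = cong₂ _+_ (⟦⟧-no (isEdge? G (u , v)) (u≮v ∘ proj₁))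
                                   (⟦⟧-yes (isEdge? G (v , u)) (v<u , symm G a))

  -- Every edge contributes `g` at both of its ends, so a vertex collects its own value once per
  -- neighbour.
  handshake : ∀ (g : Vertex G → ℕ) →
              ∑ (edges G) (λ (u , v) → g u + g v) ≡ ∑ V (λ u → degree G u * g u)
  handshake g = begin
    ∑ (edges G) (λ (u , v) → g u + g v)
      ≡⟨ ∑-filter (isEdge? G) (cartesianProduct V V) _ ⟩
    ∑ (cartesianProduct V V) (λ (u , v) → ε u v * (g u + g v))
      ≡⟨ ∑-cartesianProduct V V _ ⟩
    ∑ V (λ u → ∑ V (λ v → ε u v * (g u + g v)))
      ≡⟨ ∑-cong V (λ u → trans (∑-cong V (λ v → *-distribˡ-+ (ε u v) (g u) (g v)))
                               (∑-+ V (λ v → ε u v * g u) (λ v → ε u v * g v))) ⟩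
    ∑ V (λ u → ∑ V (λ v → ε u v * g u) + ∑ V (λ v → ε u v * g v))
      ≡⟨ ∑-+ V (λ u → ∑ V (λ v → ε u v * g u)) (λ u → ∑ V (λ v → ε u v * g v)) ⟩
    ∑ V (λ u → ∑ V (λ v → ε u v * g u)) + ∑ V (λ u → ∑ V (λ v → ε u v * g v))
      -- Exchanging the roles of the two vertices in the second double sum makes both sums carry
      -- `g u`.
      ≡⟨ cong (_+_ (∑ V (λ u → ∑ V (λ v → ε u v * g u)))) (∑-swap V V (λ u v → ε u v * g v)) ⟩
    ∑ V (λ u → ∑ V (λ v → ε u v * g u)) + ∑ V (λ u → ∑ V (λ v → ε v u * g u))
      ≡⟨ ∑-+ V (λ u → ∑ V (λ v → ε u v * g u)) (λ u → ∑ V (λ v → ε v u * g u)) ⟨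
    ∑ V (λ u → ∑ V (λ v → ε u v * g u) + ∑ V (λ v → ε v u * g u))
      ≡⟨ ∑-cong V (λ u → sym (∑-+ V (λ v → ε u v * g u) (λ v → ε v u * g u))) ⟩
    ∑ V (λ u → ∑ V (λ v → ε u v * g u + ε v u * g u))
      ≡⟨ ∑-cong V (λ u → ∑-cong V (λ v → trans (sym (*-distribʳ-+ (g u) (ε u v) (ε v u)))
                                               (cong (_* g u) (ε-symmetrised u v (adj? G u v))))) ⟩
    ∑ V (λ u → ∑ V (λ v → ⟦ adj? G u v ⟧ * g u))
      ≡⟨ ∑-cong V (λ u → trans (sym (∑-filter (adj? G u) V (λ _ → g u)))
                               (∑-const (filter (adj? G u) V) (g u))) ⟩
    ∑ V (λ u → degree G u * g u) ∎
    where open ≡-Reasoning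

-- Comparing products and sums of reciprocals

≈-refl : ∀ {e} → e ≈ e
≈-refl = inj₁ (refl , refl)

≈-sym : ∀ {e e′} → e ≈ e′ → e′ ≈ e
≈-sym (inj₁ (refl , refl)) = inj₁ (refl , refl)
≈-sym (inj₂ (refl , refl)) = inj₂ (refl , refl)

≈-trans : ∀ {e e′ e″} → e ≈ e′ → e′ ≈ e″ → e ≈ e″
≈-trans (inj₁ (refl , refl)) q                    = q
≈-trans (inj₂ (refl , refl)) (inj₁ (refl , refl)) = inj₂ (refl , refl)
≈-trans (inj₂ (refl , refl)) (inj₂ (refl , refl)) = inj₁ (refl , refl)

_≈?_ : Decidable _≈_
(a , b) ≈? (c , d) = ((a ≟ c) ×-dec (b ≟ d)) ⊎-dec ((a ≟ d) ×-dec (b ≟ c))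

π σ : ℕ × ℕ → ℕ
π (a , b) = a * b
σ (a , b) = a + b

π-cong : ∀ {e e′} → e ≈ e′ → π e ≡ π e′
π-cong         (inj₁ (refl , refl)) = refl
π-cong {a , b} (inj₂ (refl , refl)) = *-comm a b

σ-cong : ∀ {e e′} → e ≈ e′ → σ e ≡ σ e′
σ-cong         (inj₁ (refl , refl)) = refl
σ-cong {a , b} (inj₂ (refl , refl)) = +-comm a b

-- The second component says that σ / π, the sum of the reciprocals, decreases.
infix 4 _≺_
_≺_ : ℕ × ℕ → ℕ × ℕ → Set
e ≺ e′ = π e < π e′ × σ e′ * π e < σ e * π e′

≺-resp-≈ : ∀ {d d′ e e′} → d ≈ e → d′ ≈ e′ → d ≺ d′ → e ≺ e′
≺-resp-≈ p q d≺d′ rewrite π-cong p | π-cong q | σ-cong p | σ-cong q = d≺d′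

data Twins : ℕ × ℕ → ℕ × ℕ → Set where
  14-22 : Twins (1 , 4) (2 , 2)
  36-44 : Twins (3 , 6) (4 , 4)

-- {1,4} and {2,2} have equal products, {3,6} and {4,4} equal sums of reciprocals.
data Linked (e e′ : ℕ × ℕ) : Set where
  same   : e ≈ e′ → Linked e e′
  twins  : ∀ {d d′} → Twins d d′ → e ≈ d → e′ ≈ d′ → Linked e e′
  twins˘ : ∀ {d d′} → Twins d d′ → e′ ≈ d → e ≈ d′ → Linked e e′

data Comparison (e e′ : ℕ × ℕ) : Set where
  below  : e ≺ e′ → Comparison e e′
  above  : e′ ≺ e → Comparison e e′
  linked : Linked e e′ → Comparison e e′

flip-comparison : ∀ {e e′} → Comparison e e′ → Comparison e′ e
flip-comparison (below p)               = above p
flip-comparison (above p)               = below p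
flip-comparison (linked (same p))       = linked (same (≈-sym p))
flip-comparison (linked (twins t p q))  = linked (twins˘ t p q)
flip-comparison (linked (twins˘ t p q)) = linked (twins t p q)

comparison-resp-≈ : ∀ {d d′ e e′} → d ≈ e → d′ ≈ e′ → Comparison d d′ → Comparison e e′
comparison-resp-≈ p q (below r) = below (≺-resp-≈ p q r)
comparison-resp-≈ p q (above r) = above (≺-resp-≈ q p r)
comparison-resp-≈ p q (linked (same r)) =
  linked (same (≈-trans (≈-sym p) (≈-trans r q)))
comparison-resp-≈ p q (linked (twins t r s)) =
  linked (twins t (≈-trans (≈-sym p) r) (≈-trans (≈-sym q) s))
comparison-resp-≈ p q (linked (twins˘ t r s)) =
  linked (twins˘ t (≈-trans (≈-sym q) r) (≈-trans (≈-sym p) s))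

-- Naming the gap `suc k` explicitly turns a polynomial inequality into an identity for the ring
-- solver.
<-by : ∀ k {m n} → m + suc k ≡ n → m < n
<-by k {m} refl = m<m+n m z<s

<⇒≺ : ∀ {i j k l} → 0 < i → 0 < j → i < k → j ≤ l → (i , j) ≺ (k , l)
<⇒≺ {suc i} {suc j} {k} {suc l} 0<i 0<j i<k j≤l =
    <-≤-trans (*-monoˡ-< (suc j) i<k) (*-monoʳ-≤ k j≤l)
  , (begin-strict
      (k + suc l) * (suc i * suc j)                   ≡⟨ expand k (suc l) (suc i) (suc j) ⟩
      -- With `i`, `j` standing for the successors, `i k j` grows weakly as `j` is raised to `l`,
      -- and `j l i` grows strictly as `i` is raised to `k`.
      (suc i * k) * suc j + (suc j * suc l) * suc i   <⟨ +-mono-≤-< (*-monoʳ-≤ (suc i * k) j≤l)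
                                                                   (*-monoʳ-< (suc j * suc l) i<k) ⟩
      (suc i * k) * suc l + (suc j * suc l) * k       ≡⟨ contract k (suc l) (suc i) (suc j) ⟩
      (suc i + suc j) * (k * suc l)                   ∎)
  where
  open ≤-Reasoning
  expand : ∀ k l i j → (k + l) * (i * j) ≡ (i * k) * j + (j * l) * i
  expand = solve-∀
  contract : ∀ k l i j → (i * k) * l + (j * l) * k ≡ (i + j) * (k * l)
  contract = solve-∀

swapped : ∀ {a b} → (a , b) ≈ (b , a)
swapped = inj₂ (refl , refl)

compare-monotone : ∀ {i j k l} → 0 < i → 0 < j → i ≤ k → j ≤ l → Comparison (i , j) (k , l)
compare-monotone {i} {j} {k} {l} 0<i 0<j i≤k j≤l with m≤n⇒m<n∨m≡n i≤k | m≤n⇒m<n∨m≡n j≤l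
... | inj₁ i<k  | _         = below (<⇒≺ 0<i 0<j i<k j≤l)
... | inj₂ _    | inj₁ j<l  = below (≺-resp-≈ {j , i} {l , k} swapped swapped (<⇒≺ 0<j 0<i j<l i≤k))
... | inj₂ refl | inj₂ refl = linked (same ≈-refl)

i,i+2≺i+1,i+1 : ∀ i → (i , 2 + i) ≺ (1 + i , 1 + i)
i,i+2≺i+1,i+1 i = <-by 0 (product i) , <-by (2 * i + 1) (cross i)
  where
  product : ∀ i → i * (2 + i) + 1 ≡ (1 + i) * (1 + i)
  product = solve-∀
  cross : ∀ i → (1 + i + (1 + i)) * (i * (2 + i)) + suc (2 * i + 1)
        ≡ (i + (2 + i)) * ((1 + i) * (1 + i))
  cross = solve-∀

i,i+3≺i+1,i+2 : ∀ i → (i , 3 + i) ≺ (1 + i , 2 + i)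
i,i+3≺i+1,i+2 i = <-by 1 (product i) , <-by (4 * i + 5) (cross i)
  where
  product : ∀ i → i * (3 + i) + 2 ≡ (1 + i) * (2 + i)
  product = solve-∀
  cross : ∀ i → (1 + i + (2 + i)) * (i * (3 + i)) + suc (4 * i + 5)
        ≡ (i + (3 + i)) * ((1 + i) * (2 + i))
  cross = solve-∀

i,i+3≺i+2,i+2 : ∀ i → (i , 3 + i) ≺ (2 + i , 2 + i)
i,i+3≺i+2,i+2 i = <-by (i + 3) (product i) , <-by (i * i + 8 * i + 11) (cross i)
  where
  product : ∀ i → i * (3 + i) + suc (i + 3) ≡ (2 + i) * (2 + i)
  product = solve-∀
  cross : ∀ i → (2 + i + (2 + i)) * (i * (3 + i)) + suc (i * i + 8 * i + 11)
        ≡ (i + (3 + i)) * ((2 + i) * (2 + i))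
  cross = solve-∀

-- In terms of `i` the two gaps are `i - 1` and `(i - 3) * (i + 1)`, both positive from `i = 4` on.
-- Their zeros are the two ties at `i = 1` and `i = 3`, and at `i = 2` they have opposite signs.
i+1,i+1≺i,i+3 : ∀ t → let i = 4 + t in (1 + i , 1 + i) ≺ (i , 3 + i)
i+1,i+1≺i,i+3 t = <-by (2 + t) (product t) , <-by (t * t + 6 * t + 4) (cross t)
  where
  product : ∀ t → let i = 4 + t in (1 + i) * (1 + i) + suc (2 + t) ≡ i * (3 + i)
  product = solve-∀
  cross : ∀ t → let i = 4 + t in
    (i + (3 + i)) * ((1 + i) * (1 + i)) + suc (t * t + 6 * t + 4)
      ≡ (1 + i + (1 + i)) * (i * (3 + i))
  cross = solve-∀

-- At i = 2 products and sums of reciprocals are ordered alike: 10 > 9 and 7/10 > 2/3.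
compare-i,i+3-i+1,i+1 : ∀ {i} → 0 < i → i ≢ 2 → Comparison (i , 3 + i) (1 + i , 1 + i)
compare-i,i+3-i+1,i+1 {1} _ _ = linked (twins 14-22 ≈-refl ≈-refl)
compare-i,i+3-i+1,i+1 {2} _ i≢2 = contradiction refl i≢2
compare-i,i+3-i+1,i+1 {3} _ _ = linked (twins 36-44 ≈-refl ≈-refl)
compare-i,i+3-i+1,i+1 {suc (suc (suc (suc t)))} _ _ = above (i+1,i+1≺i,i+3 t)

-- The constructors are named after the offsets of j and of k, l from i.
data Nested (i : ℕ) : ℕ → ℕ → ℕ → Set where
  2-11 : Nested i (2 + i) (1 + i) (1 + i)
  3-11 : Nested i (3 + i) (1 + i) (1 + i)
  3-12 : Nested i (3 + i) (1 + i) (2 + i)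
  3-22 : Nested i (3 + i) (2 + i) (2 + i)

-- Let `x`, `y`, `z` be the slacks in `i < k`, `k ≤ l` and `l < j`. Then `j = 2 + i + (x + y + z)`,
-- so the slacks add up to at most 1: either all vanish, or exactly one of them is 1.
nested : ∀ {i j k l} → i < k → k ≤ l → l < j → j ≤ 3 + i → Nested i j k l
nested {i} i<k k≤l l<j j≤3+i
  with x , refl ← m≤n⇒∃[o]m+o≡n i<k
  with y , refl ← m≤n⇒∃[o]m+o≡n k≤l
  with z , refl ← m≤n⇒∃[o]m+o≡n l<j
  = split x y z (+-cancelˡ-≤ (2 + i) _ _ (subst₂ _≤_ (regroup i x y z) (+-comm 1 (2 + i)) j≤3+i))
  where
  regroup : ∀ i x y z → suc (suc (i + x + y + z)) ≡ 2 + i + (x + y + z)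
  regroup = solve-∀
  split : ∀ x y z → x + y + z ≤ 1 →
          Nested i (suc (suc i + x + y) + z) (suc i + x) (suc i + x + y)
  split 0 0 0 _ rewrite +-identityʳ i | +-identityʳ i | +-identityʳ i = 2-11
  split 0 0 1 _ rewrite +-identityʳ i | +-identityʳ i | +-comm i 1 = 3-11
  split 0 1 0 _ rewrite +-identityʳ i | +-comm i 1 | +-identityʳ i = 3-12
  split 1 0 0 _ rewrite +-comm i 1 | +-identityʳ i | +-identityʳ i = 3-22
  split (suc (suc _)) _ _ (s≤s ())
  split 1 (suc _) _ (s≤s ())
  split 1 0 (suc _) (s≤s ())
  split 0 (suc (suc _)) _ (s≤s ())
  split 0 1 (suc _) (s≤s ())
  split 0 0 (suc (suc _)) (s≤s ())

-- Comparing pairs whose entries lie in an interval of length at most 3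

module Compare {lo hi} (0<lo : 0 < lo) (hi≤3+lo : hi ≤ 3 + lo) (not25 : lo ≢ 2 ⊎ hi ≢ 5) where

  InRange : ℕ × ℕ → Set
  InRange (a , b) = (lo ≤ a × a ≤ hi) × (lo ≤ b × b ≤ hi)

  compare-nested : ∀ {i j k l} → lo ≤ i → j ≤ hi → i < k → k ≤ l → l < j →
                   Comparison (i , j) (k , l)
  compare-nested {i} lo≤i j≤hi i<k k≤l l<j
    with nested i<k k≤l l<j (≤-trans j≤hi (≤-trans hi≤3+lo (+-monoʳ-≤ 3 lo≤i)))
  ... | 2-11 = below (i,i+2≺i+1,i+1 i)
  ... | 3-12 = below (i,i+3≺i+1,i+2 i)
  ... | 3-22 = below (i,i+3≺i+2,i+2 i)
  -- For `i = 2` this shape has `j = 5`; as `hi ≤ 3 + lo`, the interval would then be exactly from 2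
  -- to 5, which `not25` rules out.
  ... | 3-11 = compare-i,i+3-i+1,i+1 (≤-trans 0<lo lo≤i) λ where refl → not-2-and-5 lo≤i j≤hi
    where
    not-2-and-5 : lo ≤ 2 → ¬ 5 ≤ hi
    not-2-and-5 lo≤2 5≤hi = Sum.[ (λ lo≢2 → lo≢2 lo≡2) , (λ hi≢5 → hi≢5 hi≡5) ] not25
      where
      lo≡2 : lo ≡ 2
      lo≡2 = ≤-antisym lo≤2 (+-cancelˡ-≤ 3 _ _ (≤-trans 5≤hi hi≤3+lo))
      hi≡5 : hi ≡ 5
      hi≡5 = ≤-antisym (≤-trans hi≤3+lo (+-monoʳ-≤ 3 lo≤2)) 5≤hi

  -- The pair `(k , l)` lies weakly inside `(i , j)`. A shared endpoint makes the pairs comparable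
  -- componentwise, and otherwise the nesting is strict.
  compare-crossing : ∀ {i j k l} → InRange (i , j) → InRange (k , l) → k ≤ l → i ≤ k → l ≤ j →
                     Comparison (i , j) (k , l)
  compare-crossing ((lo≤i , _) , (_ , j≤hi)) ((lo≤k , _) , (lo≤l , _)) k≤l i≤k l≤j
    with m≤n⇒m<n∨m≡n i≤k | m≤n⇒m<n∨m≡n l≤j
  ... | inj₁ i<k  | inj₁ l<j  = compare-nested lo≤i j≤hi i<k k≤l l<j
  ... | inj₁ _    | inj₂ refl = compare-monotone (≤-trans 0<lo lo≤i) (≤-trans 0<lo lo≤l) i≤k ≤-refl
  ... | inj₂ refl | _         = flip-comparison
    (compare-monotone (≤-trans 0<lo lo≤k) (≤-trans 0<lo lo≤l) ≤-refl l≤j)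

  compare-sorted : ∀ {i j k l} → InRange (i , j) → InRange (k , l) → i ≤ j → k ≤ l →
                   Comparison (i , j) (k , l)
  compare-sorted {i} {j} {k} {l} p@((lo≤i , _) , (lo≤j , _)) q@((lo≤k , _) , (lo≤l , _)) i≤j k≤l
    with ≤-total i k | ≤-total j l
  ... | inj₁ i≤k | inj₁ j≤l = compare-monotone (≤-trans 0<lo lo≤i) (≤-trans 0<lo lo≤j) i≤k j≤l
  ... | inj₁ i≤k | inj₂ l≤j = compare-crossing p q k≤l i≤k l≤j
  ... | inj₂ k≤i | inj₁ j≤l = flip-comparison (compare-crossing q p i≤j k≤i j≤l)
  ... | inj₂ k≤i | inj₂ l≤j = flip-comparison
    (compare-monotone (≤-trans 0<lo lo≤k) (≤-trans 0<lo lo≤l) k≤i l≤j)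

  sorted : ∀ {e} → InRange e → ∃₂ λ a b → a ≤ b × InRange (a , b) × (a , b) ≈ e
  sorted {a , b} (p , q) with ≤-total a b
  ... | inj₁ a≤b = a , b , a≤b , (p , q) , ≈-refl
  ... | inj₂ b≤a = b , a , b≤a , (q , p) , swapped

  compare : ∀ {e e′} → InRange e → InRange e′ → Comparison e e′
  compare p q with sorted p | sorted q
  ... | _ , _ , i≤j , r , d≈e | _ , _ , k≤l , s , d′≈e′ =
    comparison-resp-≈ d≈e d′≈e′ (compare-sorted r s i≤j k≤l)

-- Classes of pairwise linked pairs

Twins-unique : ∀ {d d′ c c′} → Twins d d′ → Twins c c′ → d ≈ c → d′ ≡ c′
Twins-unique 14-22 14-22 _ = refl
Twins-unique 36-44 36-44 _ = refl
Twins-unique 14-22 36-44 (inj₁ ())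
Twins-unique 14-22 36-44 (inj₂ ())
Twins-unique 36-44 14-22 (inj₁ ())
Twins-unique 36-44 14-22 (inj₂ ())

-- No pair is the first member of one couple of twins and the second member of another. Together
-- with `Twins-unique` this keeps a linked family from holding more than two classes.
Twins-disjoint : ∀ {d d′ c c′} → Twins d d′ → Twins c c′ → ¬ d ≈ c′
Twins-disjoint 14-22 14-22 (inj₁ ())
Twins-disjoint 14-22 14-22 (inj₂ ())
Twins-disjoint 14-22 36-44 (inj₁ ())
Twins-disjoint 14-22 36-44 (inj₂ ())
Twins-disjoint 36-44 14-22 (inj₁ ())
Twins-disjoint 36-44 14-22 (inj₂ ())
Twins-disjoint 36-44 36-44 (inj₁ ())
Twins-disjoint 36-44 36-44 (inj₂ ())

PairwiseLinked : List (ℕ × ℕ) → Set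
PairwiseLinked E = ∀ {e e′} → e ∈ E → e′ ∈ E → Linked e e′

module _ {E : List (ℕ × ℕ)} (link : PairwiseLinked E) where

  twins⇒≐ : ∀ {a b d d′} → a ∈ E → b ∈ E → Twins d d′ → a ≈ d → b ≈ d′ → ⟪ E ⟫ ≐ ⟪ d ∷ d′ ∷ [] ⟫
  twins⇒≐ {a} {b} {d} {d′} a∈ b∈ t a≈d b≈d′ = ⊆ , ⊇
    where
    ⊆ : ∀ {p} → ⟪ E ⟫ p → ⟪ d ∷ d′ ∷ [] ⟫ p
    ⊆ p∈ with find p∈
    ... | e , e∈ , p≈e with link a∈ e∈
    ...   | same a≈e = here (≈-trans p≈e (≈-trans (≈-sym a≈e) a≈d))
    ...   | twins t′ a≈c e≈c′ with refl ← Twins-unique t t′ (≈-trans (≈-sym a≈d) a≈c) =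
              there (here (≈-trans p≈e e≈c′))
    ...   | twins˘ t′ _ a≈c′ = contradiction (≈-trans (≈-sym a≈d) a≈c′) (Twins-disjoint t t′)

    ⊇ : ∀ {p} → ⟪ d ∷ d′ ∷ [] ⟫ p → ⟪ E ⟫ p
    ⊇ (here p≈d)          = lose a∈ (≈-trans p≈d (≈-sym a≈d))
    ⊇ (there (here p≈d′)) = lose b∈ (≈-trans p≈d′ (≈-sym b≈d′))

  -- If some `e′` in `E` is not `e` up to order, then `e` and `e′` can only be linked as twins, and
  -- this couple already exhausts `E`.
  one-class-or-twins : ∀ {e} → e ∈ E →
    All (_≈ e) E ⊎ ∃₂ λ d d′ → Twins d d′ × ⟪ E ⟫ ≐ ⟪ d ∷ d′ ∷ [] ⟫
  one-class-or-twins {e} e∈ with All.all? (_≈? e) E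
  ... | yes all≈e = inj₁ all≈e
  ... | no ¬all≈e with find (All.¬All⇒Any¬ (_≈? e) E ¬all≈e)
  ...   | e′ , e′∈ , e′≉e with link e∈ e′∈
  ...     | same e≈e′        = contradiction (≈-sym e≈e′) e′≉e
  ...     | twins t e≈d e′≈d′  = inj₂ (_ , _ , t , twins⇒≐ e∈ e′∈ t e≈d e′≈d′)
  ...     | twins˘ t e′≈d e≈d′ = inj₂ (_ , _ , t , twins⇒≐ e′∈ e∈ t e′≈d e≈d′)

singleton⇒linked : ∀ {E d} → ⟪ E ⟫ ≐ ⟪ d ∷ [] ⟫ → PairwiseLinked E
singleton⇒linked (⊆ , _) e∈ e′∈ with ⊆ (lose e∈ ≈-refl) | ⊆ (lose e′∈ ≈-refl)
... | here e≈d | here e′≈d = same (≈-trans e≈d (≈-sym e′≈d))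

twins⇒linked : ∀ {E d d′} → Twins d d′ → ⟪ E ⟫ ≐ ⟪ d ∷ d′ ∷ [] ⟫ → PairwiseLinked E
twins⇒linked t (⊆ , _) e∈ e′∈ with ⊆ (lose e∈ ≈-refl) | ⊆ (lose e′∈ ≈-refl)
... | here e≈d          | here e′≈d          = same (≈-trans e≈d (≈-sym e′≈d))
... | here e≈d          | there (here e′≈d′) = twins t e≈d e′≈d′
... | there (here e≈d′) | here e′≈d          = twins˘ t e′≈d e≈d′
... | there (here e≈d′) | there (here e′≈d′) = same (≈-trans e≈d′ (≈-sym e′≈d′))

-- Sums of reciprocals, scaled to natural numbers

module _ (w : ℕ → ℕ) (L : ℕ) where

  -- For positive entries this makes `w` stand for `L / a` and `L / b`, stated without division; `ω`
  -- is then `L` times the sum of reciprocals.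
  Inverts : ℕ × ℕ → Set
  Inverts (a , b) = a * w a ≡ L × b * w b ≡ L

  ω : ℕ × ℕ → ℕ
  ω (a , b) = w a + w b

  π*ω : ∀ {e} → Inverts e → π e * ω e ≡ L * σ e
  π*ω {a , b} (aw≡L , bw≡L) = begin
    a * b * (w a + w b)           ≡⟨ regroup a b (w a) (w b) ⟩
    (a * w a) * b + (b * w b) * a ≡⟨ cong₂ (λ x y → x * b + y * a) aw≡L bw≡L ⟩
    L * b + L * a                 ≡⟨ *-distribˡ-+ L b a ⟨
    L * (b + a)                   ≡⟨ cong (L *_) (+-comm b a) ⟩
    L * (a + b)                   ∎
    where
    open ≡-Reasoning
    regroup : ∀ a b x y → a * b * (x + y) ≡ (a * x) * b + (b * y) * a
    regroup = solve-∀

  -- Multiplying by both products brings the two values of `ω` to a common denominator, so that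
  -- comparing them becomes the cross-multiplied comparison in `_≺_`.
  scaled-ω : ∀ {e e′} → Inverts e → π e * π e′ * ω e ≡ L * (σ e * π e′)
  scaled-ω {e} {e′} inv = begin
    π e * π e′ * ω e   ≡⟨ regroup (π e) (π e′) (ω e) ⟩
    π e * ω e * π e′   ≡⟨ cong (_* π e′) (π*ω {e} inv) ⟩
    L * σ e * π e′     ≡⟨ *-assoc L (σ e) (π e′) ⟩
    L * (σ e * π e′)   ∎
    where
    open ≡-Reasoning
    regroup : ∀ p q x → p * q * x ≡ p * x * q
    regroup = solve-∀

  scaled-ω˘ : ∀ {e e′} → Inverts e′ → π e * π e′ * ω e′ ≡ L * (σ e′ * π e)
  scaled-ω˘ {e} {e′} inv = trans (cong (_* ω e′) (*-comm (π e) (π e′))) (scaled-ω {e′} {e} inv)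

  module _ .{{_ : NonZero L}} where

    ≺⇒ω> : ∀ {e e′} → Inverts e → Inverts e′ → e ≺ e′ → ω e′ < ω e
    ≺⇒ω> {e} {e′} inv inv′ (_ , lt) = *-cancelˡ-< (π e * π e′) (ω e′) (ω e)
      (subst₂ _<_ (sym (scaled-ω˘ {e} {e′} inv′)) (sym (scaled-ω {e} {e′} inv)) (*-monoʳ-< L lt))

    private
      nonZero-factor : ∀ a {x} → a * x ≡ L → NonZero a
      nonZero-factor a eq = m*n≢0⇒m≢0 a {{subst NonZero (sym eq) it}}

    π-nonZero : ∀ {e} → Inverts e → NonZero (π e)
    π-nonZero {a , b} (p , q) = m*n≢0 a b {{nonZero-factor a p}} {{nonZero-factor b q}}

    cross⇒ω≡ : ∀ {e e′} → Inverts e → Inverts e′ → σ e′ * π e ≡ σ e * π e′ → ω e ≡ ω e′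
    cross⇒ω≡ {e} {e′} inv inv′ eq =
      *-cancelˡ-≡ (ω e) (ω e′) (π e * π e′)
        {{m*n≢0 (π e) (π e′) {{π-nonZero {e} inv}} {{π-nonZero {e′} inv′}}}}
        (trans (scaled-ω {e} {e′} inv)
               (trans (cong (L *_) (sym eq)) (sym (scaled-ω˘ {e} {e′} inv′))))

    Twins⇒tied : ∀ {d d′ e e′} → Twins d d′ → Inverts e → Inverts e′ →
                 e ≈ d → e′ ≈ d′ → Tied π ω e e′
    Twins⇒tied 14-22 inv inv′ p q = inj₁ (trans (π-cong p) (sym (π-cong q)))
    Twins⇒tied {e = e} {e′} 36-44 inv inv′ p q = inj₂ (cross⇒ω≡ {e} {e′} inv inv′
      -- Both cross products evaluate to 144, as `8 * 18` and as `9 * 16`.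
      (trans (cong₂ _*_ (σ-cong q) (π-cong p)) (sym (cong₂ _*_ (σ-cong p) (π-cong q)))))

    linked⇒tied : ∀ {e e′} → Inverts e → Inverts e′ → Linked e e′ → Tied π ω e e′
    linked⇒tied inv inv′ (same p)       = inj₁ (π-cong p)
    linked⇒tied inv inv′ (twins t p q)  = Twins⇒tied t inv inv′ p q
    linked⇒tied inv inv′ (twins˘ t p q) = Sum.map sym sym (Twins⇒tied t inv′ inv p q)

    comparison⇒opposed : ∀ {e e′} → Inverts e → Inverts e′ → Comparison e e′ → Opposed π ω e e′
    comparison⇒opposed inv inv′ (below p) = inj₁ (<⇒≤ (proj₁ p) , <⇒≤ (≺⇒ω> inv inv′ p))
    comparison⇒opposed inv inv′ (above p) = inj₂ (<⇒≤ (proj₁ p) , <⇒≤ (≺⇒ω> inv′ inv p))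
    -- When one of the two functions ties, the pairs are opposed whichever way the other one is
    -- ordered.
    comparison⇒opposed {e} {e′} inv inv′ (linked l) with linked⇒tied inv inv′ l
    ... | inj₁ π≡ = Sum.map (≤-reflexive π≡ ,_) (≤-reflexive (sym π≡) ,_) (≤-total (ω e′) (ω e))
    ... | inj₂ ω≡ = Sum.map (_, ≤-reflexive (sym ω≡)) (_, ≤-reflexive ω≡) (≤-total (π e) (π e′))

    -- In `below` and `above` both `π` and `ω` differ strictly, so a tie leaves only the linked
    -- case.
    tied⇒linked : ∀ {e e′} → Inverts e → Inverts e′ → Comparison e e′ → Tied π ω e e′ → Linked e e′
    tied⇒linked inv inv′ (linked l) _         = l
    tied⇒linked inv inv′ (below p)  (inj₁ π≡) = contradiction π≡ (<⇒≢ (proj₁ p))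
    tied⇒linked inv inv′ (below p)  (inj₂ ω≡) = contradiction (sym ω≡) (<⇒≢ (≺⇒ω> inv inv′ p))
    tied⇒linked inv inv′ (above p)  (inj₁ π≡) = contradiction (sym π≡) (<⇒≢ (proj₁ p))
    tied⇒linked inv inv′ (above p)  (inj₂ ω≡) = contradiction ω≡ (<⇒≢ (≺⇒ω> inv′ inv p))

-- Junk value 0 at d = 0.
cofactor : ℕ → ℕ → ℕ
cofactor n zero    = 0
cofactor n (suc d) = (n !) ℕ./ suc d

-- A positive `d` divides `d !`, which divides `n !` when `d ≤ n`.
*-cofactor : ∀ {n d} → 0 < d → d ≤ n → d * cofactor n d ≡ n !
*-cofactor {n} {suc d} _ d≤n = m*[n/m]≡n (∣-trans (m∣m*n (d !)) (m≤n⇒m!∣n! d≤n))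

-- The degree pairs of a graph and its extremal degrees

module _ (G : Graph) where

  degreePair : Vertex G × Vertex G → ℕ × ℕ
  degreePair (u , v) = degree G u , degree G v

  -- A list keeps multiplicities, which the sums over edges count; `𝔽≐E` passes to the underlying
  -- set of unordered pairs.
  degreePairs : List (ℕ × ℕ)
  degreePairs = map degreePair (edges G)

  edge⇒∈E : ∀ {u v} → IsEdge G (u , v) → degreePair (u , v) ∈ degreePairs
  edge⇒∈E = ∈-map⁺ degreePair ∘
    ∈-filter⁺ (isEdge? G) (∈-cartesianProduct⁺ (∈-allFin _) (∈-allFin _))

  adjacent⇒∈E : ∀ {u v} → Adj G u v → ∃ λ e → e ∈ degreePairs × e ≈ degreePair (u , v)
  adjacent⇒∈E {u} {v} a with <-cmp u v
  ... | tri< u<v _ _ = _ , edge⇒∈E (u<v , a) , ≈-refl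
  ... | tri≈ _ u≡v _ = contradiction a (irrefl G u≡v)
  ... | tri> _ _ v<u = _ , edge⇒∈E (v<u , symm G a) , swapped

  ∈E⇒adjacent : ∀ {e} → e ∈ degreePairs → ∃₂ λ u v → Adj G u v × e ≡ degreePair (u , v)
  ∈E⇒adjacent e∈ with ∈-map⁻ degreePair {xs = edges G} e∈
  ... | (u , v) , uv∈ , refl = u , v , proj₂ isEdge , refl
    where
    isEdge : IsEdge G (u , v)
    isEdge = proj₂ (∈-filter⁻ (isEdge? G) {xs = cartesianProduct (vertices G) (vertices G)} uv∈)

  𝔽≐E : 𝔽 G ≐ ⟪ degreePairs ⟫
  𝔽≐E = ⊆ , ⊇
    where
    ⊆ : ∀ {p} → 𝔽 G p → ⟪ degreePairs ⟫ p
    ⊆ (u , v , a , p≈uv) with adjacent⇒∈E a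
    ... | e , e∈ , e≈uv = lose e∈ (≈-trans p≈uv (≈-sym e≈uv))
    ⊇ : ∀ {p} → ⟪ degreePairs ⟫ p → 𝔽 G p
    ⊇ p∈ with find p∈
    ... | e , e∈ , p≈e with ∈E⇒adjacent e∈
    ...   | u , v , a , refl = u , v , a , p≈e

  degree∈degrees : ∀ u → degree G u ∈ degrees G
  degree∈degrees u = ∈-map⁺ (degree G) (∈-allFin u)

  degree≤Δ : ∀ u → degree G u ≤ Δ G
  degree≤Δ u = All.lookup (xs≤max 0 (degrees G)) (degree∈degrees u)

  δ≤degree : ∀ u → δ G ≤ degree G u
  δ≤degree u = All.lookup (min≤xs (Δ G) (degrees G)) (degree∈degrees u)

  Δ≤ : ∀ {b} → (∀ u → degree G u ≤ b) → Δ G ≤ b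
  Δ≤ deg≤b = max≤v⁺ z≤n (All.map⁺ (All.universal deg≤b (vertices G)))

  -- The minimum defining `δ` starts from `Δ G`, so a lower bound must hold for that starting value
  -- too.
  ≤δ : ∀ {a} → a ≤ Δ G → (∀ u → a ≤ degree G u) → a ≤ δ G
  ≤δ a≤Δ a≤deg = v≤min⁺ a≤Δ (All.map⁺ (All.universal a≤deg (vertices G)))

  module _ (noIso : NoIsolated G) where

    -- Each vertex lies on an edge, so its degree is one of the two entries of the only class. All
    -- degrees thus lie between these entries, and both are attained.
    one-class⇒extremal : ∀ {u v} → degree G u ≤ degree G v →
                         All (_≈ degreePair (u , v)) degreePairs → degreePair (u , v) ≈ (Δ G , δ G)
    one-class⇒extremal {u} {v} du≤dv all≈ = inj₂
      ( ≤-antisym (≤δ (degree≤Δ u) (proj₁ ∘ between)) (δ≤degree u)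
      , ≤-antisym (degree≤Δ v) (Δ≤ (proj₂ ∘ between)))
      where
      between : ∀ x → degree G u ≤ degree G x × degree G x ≤ degree G v
      between x with noIso x
      ... | y , a with adjacent⇒∈E a
      ...   | e , e∈ , e≈xy with ≈-trans (≈-sym e≈xy) (All.lookup all≈ e∈)
      ...     | inj₁ (dx≡du , _) = ≤-reflexive (sym dx≡du) , ≤-trans (≤-reflexive dx≡du) du≤dv
      ...     | inj₂ (dx≡dv , _) = ≤-trans du≤dv (≤-reflexive (sym dx≡dv)) , ≤-reflexive dx≡dv

    one-class⇒≐ : ∀ {e} → e ∈ degreePairs → All (_≈ e) degreePairs →
                  ⟪ degreePairs ⟫ ≐ ⟪ (Δ G , δ G) ∷ [] ⟫
    one-class⇒≐ {e} e∈ all≈ = ⊆ , ⊇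
      where
      e≈Δδ : e ≈ (Δ G , δ G)
      e≈Δδ with ∈E⇒adjacent e∈
      ... | u , v , _ , refl with ≤-total (degree G u) (degree G v)
      ...   | inj₁ du≤dv = one-class⇒extremal du≤dv all≈
      -- The endpoints are exchanged so that the smaller degree comes first.
      ...   | inj₂ dv≤du = ≈-trans swapped
        (one-class⇒extremal dv≤du (All.map (λ p → ≈-trans p swapped) all≈))

      ⊆ : ∀ {p} → ⟪ degreePairs ⟫ p → ⟪ (Δ G , δ G) ∷ [] ⟫ p
      ⊆ p∈ with find p∈
      ... | e′ , e′∈ , p≈e′ = here (≈-trans p≈e′ (≈-trans (All.lookup all≈ e′∈) e≈Δδ))

      ⊇ : ∀ {p} → ⟪ (Δ G , δ G) ∷ [] ⟫ p → ⟪ degreePairs ⟫ p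
      ⊇ (here p≈Δδ) = lose e∈ (≈-trans p≈Δδ (≈-sym e≈Δδ))

    0<degree : ∀ u → 0 < degree G u
    0<degree u with noIso u
    ... | v , a = ∈-length (∈-filter⁺ (adj? G u) (∈-allFin v) a)

-- Chebyshev's inequality applied to the degree pairs

module Main (G : Graph) (noIso : NoIsolated G) (u₀ : Vertex G)
            (Δ∸δ≤3 : Δ G ∸ δ G ≤ 3) (not25 : δ G ≢ 2 ⊎ Δ G ≢ 5) where

  0<δ : 0 < δ G
  0<δ = ≤δ G (≤-trans (0<degree G noIso u₀) (degree≤Δ G u₀)) (0<degree G noIso)

  Δ≤3+δ : Δ G ≤ 3 + δ G
  Δ≤3+δ = ≤-trans (m≤n+m∸n (Δ G) (δ G))
    (≤-trans (+-monoʳ-≤ (δ G) Δ∸δ≤3) (≤-reflexive (+-comm (δ G) 3)))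

  open Compare 0<δ Δ≤3+δ not25

  -- All degrees are positive and at most `Δ G`, so this factorial is a common multiple of them.
  L : ℕ
  L = Δ G !

  w : ℕ → ℕ
  w = cofactor (Δ G)

  instance
    L≢0 : NonZero L
    L≢0 = Δ G !≢0

  degree-w : ∀ u → degree G u * w (degree G u) ≡ L
  degree-w u = *-cofactor (0<degree G noIso u) (degree≤Δ G u)

  inverts : ∀ {e} → e ∈ degreePairs G → Inverts w L e
  inverts e∈ with ∈E⇒adjacent G e∈
  ... | u , v , _ , refl = degree-w u , degree-w v

  comparison : ∀ {e e′} → e ∈ degreePairs G → e′ ∈ degreePairs G → Comparison e e′
  comparison e∈ e′∈ with ∈E⇒adjacent G e∈ | ∈E⇒adjacent G e′∈
  ... | u , v , _ , refl | u′ , v′ , _ , refl = compare (inRange u v) (inRange u′ v′)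
    where
    inRange : ∀ u v → InRange (degree G u , degree G v)
    inRange u v = (δ≤degree G u , degree≤Δ G u) , (δ≤degree G v , degree≤Δ G v)

  W : ℕ × ℕ → ℕ
  W = ω w L

  ∑π : ∑ (degreePairs G) π ≡ M₂ G
  ∑π = ∑-map (degreePair G) (edges G) π

  -- By the handshake identity a vertex of degree `d` receives `L / d` from each of its `d` edges,
  -- hence `L` in total.
  ∑W : ∑ (degreePairs G) W ≡ order G * L
  ∑W = begin
    ∑ (degreePairs G) W
      ≡⟨ ∑-map (degreePair G) (edges G) W ⟩
    ∑ (edges G) (λ (u , v) → w (degree G u) + w (degree G v))
      ≡⟨ handshake G (w ∘ degree G) ⟩
    ∑ (vertices G) (λ u → degree G u * w (degree G u))
      ≡⟨ ∑-cong (vertices G) degree-w ⟩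
    ∑ (vertices G) (λ _ → L)
      ≡⟨ ∑-const (vertices G) L ⟩
    length (vertices G) * L
      ≡⟨ cong (_* L) (length-tabulate {n = order G} (λ u → u)) ⟩
    order G * L ∎
    where open ≡-Reasoning

  -- Since `π * W` is `L * σ` on each edge, this is the handshake identity with the degree itself as
  -- weight.
  ∑πW : ∑ (degreePairs G) (λ e → π e * W e) ≡ L * M₁ G
  ∑πW = begin
    ∑ (degreePairs G) (λ e → π e * W e)
      ≡⟨ ∑-map (degreePair G) (edges G) (λ e → π e * W e) ⟩
    ∑ (edges G) (λ e → π (degreePair G e) * W (degreePair G e))
      ≡⟨ ∑-cong (edges G) (λ (u , v) → π*ω w L {degreePair G (u , v)} (degree-w u , degree-w v)) ⟩
    ∑ (edges G) (λ e → L * σ (degreePair G e))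
      ≡⟨ ∑-*ˡ (edges G) L (σ ∘ degreePair G) ⟩
    L * ∑ (edges G) (λ (u , v) → degree G u + degree G v)
      ≡⟨ cong (L *_) (handshake G (degree G)) ⟩
    L * ∑ (vertices G) (λ u → degree G u * degree G u)
      -- The square `d ^ 2` unfolds to `d * (d * 1)`.
      ≡⟨ cong (L *_) (∑-cong (vertices G)
           (λ u → cong (degree G u *_) (sym (*-identityʳ (degree G u))))) ⟩
    L * M₁ G ∎
    where open ≡-Reasoning

  scaled-left : length (degreePairs G) * ∑ (degreePairs G) (λ e → π e * W e) ≡ L * (M₁ G * size G)
  scaled-left = trans (cong₂ _*_ (length-map (degreePair G) (edges G)) ∑πW)
                      (regroup (size G) L (M₁ G))
    where
    regroup : ∀ a b c → a * (b * c) ≡ b * (c * a)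
    regroup = solve-∀

  scaled-right : ∑ (degreePairs G) π * ∑ (degreePairs G) W ≡ L * (M₂ G * order G)
  scaled-right = trans (cong₂ _*_ ∑π ∑W) (regroup (M₂ G) (order G) L)
    where
    regroup : ∀ a b c → a * (b * c) ≡ c * (a * b)
    regroup = solve-∀

  open Chebyshev (degreePairs G) π W

  opposed : ∀ {e e′} → e ∈ degreePairs G → e′ ∈ degreePairs G → Opposed π W e e′
  opposed e∈ e′∈ = comparison⇒opposed w L (inverts e∈) (inverts e′∈) (comparison e∈ e′∈)

  inequality : M₁ G * size G ≤ M₂ G * order G
  inequality = *-cancelˡ-≤ L (subst₂ _≤_ scaled-left scaled-right (chebyshev opposed))

  equality⇒linked : M₁ G * size G ≡ M₂ G * order G → PairwiseLinked (degreePairs G)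
  equality⇒linked eq e∈ e′∈ =
    tied⇒linked w L (inverts e∈) (inverts e′∈) (comparison e∈ e′∈)
      (chebyshev-≡⇒tied opposed
        (trans scaled-left (trans (cong (L *_) eq) (sym scaled-right))) e∈ e′∈)

  linked⇒equality : PairwiseLinked (degreePairs G) → M₁ G * size G ≡ M₂ G * order G
  linked⇒equality link = *-cancelˡ-≡ _ _ L
    (trans (sym scaled-left) (trans (tied⇒chebyshev-≡ opposed tied) scaled-right))
    where
    tied : ∀ {e e′} → e ∈ degreePairs G → e′ ∈ degreePairs G → Tied π W e e′
    tied e∈ e′∈ = linked⇒tied w L (inverts e∈) (inverts e′∈) (link e∈ e′∈)

  Extremal : Set
  Extremal = (𝔽 G ≐ ⟪ (Δ G , δ G) ∷ [] ⟫)
           ⊎ (𝔽 G ≐ ⟪ (1 , 4) ∷ (2 , 2) ∷ [] ⟫)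
           ⊎ (𝔽 G ≐ ⟪ (3 , 6) ∷ (4 , 4) ∷ [] ⟫)

  linked⇒extremal : PairwiseLinked (degreePairs G) → Extremal
  -- An edge at `u₀` supplies a member of `degreePairs G` as the reference class.
  linked⇒extremal link with adjacent⇒∈E G (proj₂ (noIso u₀))
  ... | e , e∈ , _ with one-class-or-twins link e∈
  ...   | inj₁ all≈e                = inj₁ (≐-trans (𝔽≐E G) (one-class⇒≐ G noIso e∈ all≈e))
  ...   | inj₂ (_ , _ , 14-22 , E≐) = inj₂ (inj₁ (≐-trans (𝔽≐E G) E≐))
  ...   | inj₂ (_ , _ , 36-44 , E≐) = inj₂ (inj₂ (≐-trans (𝔽≐E G) E≐))

  extremal⇒linked : Extremal → PairwiseLinked (degreePairs G)
  extremal⇒linked (inj₁ 𝔽≐)        = singleton⇒linked (≐-trans (≐-sym (𝔽≐E G)) 𝔽≐)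
  extremal⇒linked (inj₂ (inj₁ 𝔽≐)) = twins⇒linked 14-22 (≐-trans (≐-sym (𝔽≐E G)) 𝔽≐)
  extremal⇒linked (inj₂ (inj₂ 𝔽≐)) = twins⇒linked 36-44 (≐-trans (≐-sym (𝔽≐E G)) 𝔽≐)

-- Fractions compared by cross multiplication

/-mono-≤ : ∀ a b n m .{{_ : NonZero n}} .{{_ : NonZero m}} → a * m ≤ b * n → (+ a / n) ℚ.≤ (+ b / m)
/-mono-≤ a b (suc n) (suc m) le = ℚ.toℚᵘ-cancel-≤
  (ℚᵘ.≤-respˡ-≃ (ℚᵘ.≃-sym (ℚ.toℚᵘ-fromℚᵘ (mkℚᵘ (+ a) n)))
    (ℚᵘ.≤-respʳ-≃ (ℚᵘ.≃-sym (ℚ.toℚᵘ-fromℚᵘ (mkℚᵘ (+ b) m)))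
      (ℚᵘ.*≤* (subst₂ ℤ._≤_ (ℤ.pos-* a (suc m)) (ℤ.pos-* b (suc n)) (ℤ.+≤+ le)))))

-- Normalisation of fractions respects and reflects equivalence of unnormalised ones, which is an
-- equation of integer cross products.
/-≡⇔*≡* : ∀ a b n m .{{_ : NonZero n}} .{{_ : NonZero m}} → (+ a / n ≡ + b / m) ⇔ (a * m ≡ b * n)
/-≡⇔*≡* a b (suc n) (suc m) = mk⇔ to from
  where
  to : + a / suc n ≡ + b / suc m → a * suc m ≡ b * suc n
  to eq with ℚ.fromℚᵘ-injective {mkℚᵘ (+ a) n} {mkℚᵘ (+ b) m} eq
  ... | ℚᵘ.*≡* eq′ = ℤ.+-injective (trans (ℤ.pos-* a (suc m)) (trans eq′ (sym (ℤ.pos-* b (suc n)))))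
  from : a * suc m ≡ b * suc n → + a / suc n ≡ + b / suc m
  from eq = ℚ.fromℚᵘ-cong {mkℚᵘ (+ a) n} {mkℚᵘ (+ b) m}
    (ℚᵘ.*≡* (trans (sym (ℤ.pos-* a (suc m))) (trans (cong +_ eq) (ℤ.pos-* b (suc n)))))

theorem2p1 : (G : Graph) .{{_ : NonZero (order G)}} (noIso : NoIsolated G) →
    Δ G ∸ δ G ≤ 3 →
    (δ G ≢ 2) ⊎ (Δ G ≢ 5) →
    let instance
          m≢0 : NonZero (size G)
          m≢0 = size-nonZero G noIso
    in
    (+ M₁ G / order G) ℚ.≤ (+ M₂ G / size G)
    ×
    ((+ M₁ G / order G ≡ + M₂ G / size G)
      ⇔
     ((𝔽 G ≐ ⟪ (Δ G , δ G) ∷ [] ⟫)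
      ⊎ (𝔽 G ≐ ⟪ (1 , 4) ∷ (2 , 2) ∷ [] ⟫)
      ⊎ (𝔽 G ≐ ⟪ (3 , 6) ∷ (4 , 4) ∷ [] ⟫)))
theorem2p1 G@(record { order = suc _ }) noIso Δ∸δ≤3 not25 =
    /-mono-≤ (M₁ G) (M₂ G) (order G) (size G) inequality
  , mk⇔ (linked⇒extremal ∘ equality⇒linked ∘ Equivalence.to crossMultiplied)
        (Equivalence.from crossMultiplied ∘ linked⇒equality ∘ extremal⇒linked)
  where
  -- The order being a successor, `Fin.zero` serves as the base vertex.
  open Main G noIso Fin.zero Δ∸δ≤3 not25

  instance
    size≢0 : NonZero (size G)
    size≢0 = size-nonZero G noIso

  crossMultiplied : (+ M₁ G / order G ≡ + M₂ G / size G) ⇔ (M₁ G * size G ≡ M₂ G * order G)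
  crossMultiplied = /-≡⇔*≡* (M₁ G) (M₂ G) (order G) (size G)
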